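{- Let $t \in \mathbb{N}$ and let $k$ be an integer with $k \ge 5490 + 45t$. Let $G$ be a finite graph that contains none of the cycles $C_3, C_5, \dots, C_{2k-1}$ as a subgraph (i.e. $G$ has no odd cycle of length less than $2k+1$), and suppose that the minimum degree of $G$ is at least $\frac{1}{2k+t}|V(G)|$. Then $G$ is $3$-colourable. Equivalently, for all such $k$, $\delta_{\chi}(\mathcal{C}_{2k-1},3)\le \frac{1}{2k+t}$.
   Context: $\mathcal{C}_{2k-1}=\{C_3,C_5,\dots,C_{2k-1}\}$ denotes the family of odd cycles of length at most $2k-1$. For a finite family $\mathcal{H}$ of graphs and an integer $c\ge 2$, $\delta_\chi(\mathcal{H},c)$ is the infimum of all $\alpha\in[0,1]$ such that every graph $G$ containing no member of $\mathcal{H}$ as a subgraph and with minimum degree at least $\alpha|V(G)|$ satisfies $\chi(G)\le c$. -}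

module Defs where

open import Data.Empty using (⊥)
open import Data.Fin using (Fin; toℕ)
open import Data.Fin.Properties using (toℕ<n)
open import Data.Integer using (+_)
open import Data.List using (List; map; filter; length; allFin; upTo)
open import Data.List.Extrema.Nat using (min)
open import Data.List.Relation.Unary.All using (All)
open import Data.Nat using (ℕ; suc; _+_; _*_; _∸_; _≥_; _%_; NonZero; _≟_)
open import Data.Nat.DivMod using (m<n⇒m%n≡m; n%n≡0)
open import Data.Nat.Properties using (m≤n⇒m<n∨m≡n; 1+n≢n)
open import Data.Product using (Σ-syntax; ∃-syntax; _×_)
open import Data.Rational as ℚ using (ℚ; 0ℚ; 1ℚ; _/_)
open import Data.Sum using (_⊎_; inj₁; inj₂; [_,_]; swap)
open import Function.Definitions using (Injective)
open import Level using (0ℓ)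
open import Relation.Binary using (Rel; Symmetric; Irreflexive; Decidable)
open import Relation.Binary.PropositionalEquality using (_≡_; _≢_; refl; sym; trans; cong)
open import Relation.Nullary using (¬_)
open import Relation.Nullary.Decidable using (_⊎-dec_)

record Graph : Set₁ where
  field
    order  : ℕ
    Adj    : Rel (Fin order) 0ℓ
    adj?   : Decidable Adj
    symm   : Symmetric Adj
    irrefl : Irreflexive _≡_ Adj

  Vertex : Set
  Vertex = Fin order

  degree : Vertex → ℕ
  degree v = length (filter (adj? v) (allFin order))

  -- Every degree is less than the order, so the default value `order` of
  -- `min` is only attained by the graph without vertices.
  minDegree : ℕ
  minDegree = min order (map degree (allFin order))

open Graph public using (order; Vertex; minDegree)

-- Subgraph containment up to isomorphism; not necessarily induced.
_⊑_ : Graph → Graph → Set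
H ⊑ G = Σ[ f ∈ (Vertex H → Vertex G) ]
          (Injective _≡_ _≡_ f × (∀ {u v} → Graph.Adj H u v → Graph.Adj G (f u) (f v)))

_IsFreeOf_ : Graph → List Graph → Set₁
G IsFreeOf ℋ = All (λ H → ¬ (H ⊑ G)) ℋ

Colourable : ℕ → Graph → Set
Colourable c G = Σ[ f ∈ (Vertex G → Fin c) ] (∀ {u v} → Graph.Adj G u v → f u ≢ f v)

ℕ→ℚ : ℕ → ℚ
ℕ→ℚ n = + n / 1

module _ (ℓ : ℕ) where

  Next : Rel (Fin (3 + ℓ)) 0ℓ
  Next i j = toℕ j ≡ suc (toℕ i) % (3 + ℓ)

  next? : Decidable Next
  next? i j = toℕ j ≟ suc (toℕ i) % (3 + ℓ)

  next-irrefl : ∀ i → ¬ Next i i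
  next-irrefl i eq with m≤n⇒m<n∨m≡n (toℕ<n i)
  ... | inj₁ lt = 1+n≢n (sym (trans eq (m<n⇒m%n≡m lt)))
  ... | inj₂ e  = absurd (trans (sym e) (cong suc (trans eq (trans (cong (_% (3 + ℓ)) e) (n%n≡0 (3 + ℓ))))))
    where
    absurd : 3 + ℓ ≡ 1 → ⊥
    absurd ()

  -- The cycle C_{3+ℓ}, on the residues modulo 3 + ℓ.
  cycle3+ : Graph
  cycle3+ = record
    { order  = 3 + ℓ
    ; Adj    = λ i j → Next i j ⊎ Next j i
    ; adj?   = λ i j → next? i j ⊎-dec next? j i
    ; symm   = swap
    ; irrefl = λ { {i} refl → [ next-irrefl i , next-irrefl i ] }
    }

-- 𝒞_{2k-1} = {C_3, C_5, …, C_{2k-1}}: the lengths are 3 + 2i for i < k - 1.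
𝒞[2_-1] : ℕ → List Graph
𝒞[2 k -1] = map (λ i → cycle3+ (2 * i)) (upTo (k ∸ 1))

-- The set of α ∈ [0,1] whose infimum is δ_χ(ℋ,c).  It is upward closed in
-- [0,1], so restricting to rational α does not change the infimum.
δχ-Admissible : List Graph → ℕ → ℚ → Set₁
δχ-Admissible ℋ c α =
  0ℚ ℚ.≤ α × α ℚ.≤ 1ℚ ×
  (∀ (G : Graph) → G IsFreeOf ℋ → α ℚ.* ℕ→ℚ (order G) ℚ.≤ ℕ→ℚ (minDegree G) → Colourable c G)

-- inf S ≤ β, without forming the (real) infimum: S has elements below every
-- r > β.
infimum_atMost_ : (ℚ → Set₁) → ℚ → Set₁
infimum S atMost β = ∀ (r : ℚ) → β ℚ.< r → ∃[ α ] (S α × α ℚ.< r)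

δχ[_,_]≤_ : List Graph → ℕ → ℚ → Set₁
δχ[ ℋ , c ]≤ β = infimum (δχ-Admissible ℋ c) atMost β

2k+t-nonZero : ∀ t k → k ≥ 5490 + 45 * t → NonZero (2 * k + t)
2k+t-nonZero t (suc k) _ = _

{-# OPTIONS --safe #-}
module Submission where

open import Data.Bool using (Bool; true; false; not; _∨_; _xor_)
open import Data.Bool.Properties using (¬-not; not-distribˡ-xor; not-involutive; not-injective; xor-identityʳ) renaming (_≟_ to _≟ᵇ_)
open import Data.Empty using (⊥-elim)
open import Data.Fin as Fin using (Fin; toℕ; fromℕ<)
import Data.Fin.Properties as Fin
import Data.Integer as ℤ
import Data.Integer.Properties as ℤ
open import Data.List using (List; []; _∷_; map; filter; length; concatMap; allFin; upTo; lookup)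
open import Data.List.Extrema.Nat using (min≤xs)
open import Data.List.Membership.Propositional using (_∈_; find; lose)
open import Data.List.Membership.Propositional.Properties using (∈-map⁺; ∈-upTo⁺; ∈-upTo⁻; ∈-map⁻; ∈-allFin; ∈-filter⁺; ∈-filter⁻; ∈-concatMap⁺)
open import Data.List.Properties using (length-++; length-map; length-upTo; length-tabulate)
open import Data.List.Relation.Unary.All as All using (All; []; _∷_)
open import Data.List.Relation.Unary.All.Properties using (¬Any⇒All¬)
open import Data.List.Relation.Unary.AllPairs as AllPairs using (AllPairs; []; _∷_)
open import Data.List.Relation.Unary.Any as Any using (Any; here; there)
open import Data.List.Relation.Unary.Any.Properties using (lookup-index)
open import Data.List.Relation.Unary.Unique.Propositional using (Unique)
import Data.List.Relation.Unary.Unique.Propositional.Properties as Unique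
open import Data.Nat using (ℕ; zero; suc; _+_; _*_; _∸_; _≤_; _<_; _≥_; z≤n; s≤s; _≟_; _<?_; _≤?_; _%_; NonZero)
import Data.Nat as ℕ
open import Data.Nat.DivMod using (m<n⇒m%n≡m; n%n≡0; m≡m%n+[m/n]*n; m%n<n; m/n*n≤m; /-monoˡ-≤)
open import Data.Nat.Induction using (<-wellFounded)
open import Data.Nat.ListAction using (sum)
open import Data.Nat.Properties
open import Data.Nat.Solver using (module +-*-Solver)
open import Data.Product using (Σ-syntax; ∃-syntax; _×_; _,_; proj₁; proj₂)
open import Data.Rational as ℚ using (ℚ; _/_)
import Data.Rational.Properties as ℚ
open import Data.Rational.Unnormalised as ℚᵘ using (mkℚᵘ)
import Data.Rational.Unnormalised.Properties as ℚᵘ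
open import Data.Sum using (_⊎_; inj₁; inj₂)
open import Data.Unit using (⊤; tt)
open import Function using (_∘_; case_of_)
open import Induction.WellFounded using (Acc; acc)
open import Level using (0ℓ)
open import Relation.Binary using (Rel; Symmetric; Decidable; tri<; tri≈; tri>)
open import Relation.Binary.PropositionalEquality
open import Relation.Nullary using (¬_; Dec; yes; no; contradiction)
open import Relation.Nullary.Decidable using (_×-dec_; _⊎-dec_; ¬?; ⌊_⌋)
import Relation.Unary as U
open import Defs

open +-*-Solver using (solve; _:+_; _:*_; _:=_; con)

-- Let m = 2k + t, so that n ≤ mδ, and let P be a maximal set of vertices with disjoint
-- neighbourhoods: |P| ≤ m, and every vertex shares a neighbour with a point of P.  Choose
-- vertices far apart whose balls of radius about k/4 cover everything; each such ball contains
-- a linear number of points of P, so there are at most 49 of them.  Around each centre, averaging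
-- over radii below k gives a sphere meeting the 2-neighbourhoods of at most 15 points of P.  Let U
-- be the union of these spheres.  Off U every component lies in a ball of radius less than k and is
-- 2-coloured by the parity of the distance to the centre.  The closed neighbourhood of U lies within
-- distance 3 of at most 735 points, so its components have diameter too small for an odd cycle, and
-- it is 2-colourable as well.  The two 2-colourings combine into a 3-colouring of the whole graph.

-- Counting

∑ : {A : Set} → List A → (A → ℕ) → ℕ
∑ xs f = sum (map f xs)

𝟙 : {P : Set} → Dec P → ℕ
𝟙 (yes _) = 1
𝟙 (no _)  = 0

𝟙-≤1 : {P : Set} (P? : Dec P) → 𝟙 P? ≤ 1
𝟙-≤1 (yes _) = ≤-refl
𝟙-≤1 (no _)  = z≤n

𝟙-no : {P : Set} (P? : Dec P) → ¬ P → 𝟙 P? ≡ 0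
𝟙-no (yes p) ¬p = contradiction p ¬p
𝟙-no (no _)  _  = refl

𝟙-yes : {P : Set} (P? : Dec P) → P → 1 ≤ 𝟙 P?
𝟙-yes (yes _) _ = ≤-refl
𝟙-yes (no ¬p) p = contradiction p ¬p

∑-mono : ∀ {A : Set} (xs : List A) {f g : A → ℕ} → (∀ x → f x ≤ g x) → ∑ xs f ≤ ∑ xs g
∑-mono []       f≤g = z≤n
∑-mono (x ∷ xs) f≤g = +-mono-≤ (f≤g x) (∑-mono xs f≤g)

∑-≤* : ∀ {A : Set} (xs : List A) {f : A → ℕ} {c} → (∀ x → f x ≤ c) → ∑ xs f ≤ length xs * c
∑-≤* []       f≤c = z≤n
∑-≤* (x ∷ xs) f≤c = +-mono-≤ (f≤c x) (∑-≤* xs f≤c)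

*-≤∑ : ∀ {A : Set} {xs : List A} {f : A → ℕ} {c} → All (λ x → c ≤ f x) xs → length xs * c ≤ ∑ xs f
*-≤∑ []           = z≤n
*-≤∑ (c≤f ∷ c≤fs) = +-mono-≤ c≤f (*-≤∑ c≤fs)

∑-zero : ∀ {A : Set} {xs : List A} {f : A → ℕ} → All (λ x → f x ≡ 0) xs → ∑ xs f ≡ 0
∑-zero []         = refl
∑-zero (eq ∷ eqs) = cong₂ _+_ eq (∑-zero eqs)

∑-+ : ∀ {A : Set} (xs : List A) (f g : A → ℕ) → ∑ xs (λ x → f x + g x) ≡ ∑ xs f + ∑ xs g
∑-+ []       f g = refl
∑-+ (x ∷ xs) f g = trans (cong ((f x + g x) +_) (∑-+ xs f g)) (+-interchange (f x) (g x) (∑ xs f) (∑ xs g))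
  where open import Algebra.Properties.CommutativeSemigroup +-commutativeSemigroup using () renaming (interchange to +-interchange)

∑-swap : ∀ {A B : Set} (xs : List A) (ys : List B) (f : A → B → ℕ) →
         ∑ xs (λ x → ∑ ys (f x)) ≡ ∑ ys (λ y → ∑ xs (λ x → f x y))
∑-swap []       ys f = sym (∑-zero (All.universal (λ _ → refl) ys))
∑-swap (x ∷ xs) ys f = trans (cong (∑ ys (f x) +_) (∑-swap xs ys f)) (sym (∑-+ ys (f x) _))

∈⇒≤∑ : ∀ {A : Set} {xs : List A} {x} (f : A → ℕ) → x ∈ xs → f x ≤ ∑ xs f
∈⇒≤∑ f (here refl)  = m≤m+n _ _
∈⇒≤∑ f (there x∈xs) = ≤-trans (∈⇒≤∑ f x∈xs) (m≤n+m _ _)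

-- At most one term is nonzero, so a bound on single terms bounds the sum.
∑-exclusive : ∀ {A : Set} {xs : List A} {f : A → ℕ} {c} → (∀ x → f x ≤ c) →
              AllPairs (λ x y → f x ≡ 0 ⊎ f y ≡ 0) xs → ∑ xs f ≤ c
∑-exclusive f≤c [] = z≤n
∑-exclusive {xs = x ∷ xs} {f} f≤c (x∦xs ∷ xs∦) with f x ≟ 0
... | yes fx≡0 = subst (λ z → z + ∑ xs f ≤ _) (sym fx≡0) (∑-exclusive f≤c xs∦)
... | no  fx≢0 = subst (_≤ _) (sym (trans (cong (f x +_) (∑-zero (All.map rest x∦xs))) (+-identityʳ _))) (f≤c x)
  where
  rest : ∀ {y} → f x ≡ 0 ⊎ f y ≡ 0 → f y ≡ 0
  rest (inj₁ fx≡0) = contradiction fx≡0 fx≢0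
  rest (inj₂ fy≡0) = fy≡0

∑-𝟙-exclusive : ∀ {A : Set} {P : A → Set} (P? : U.Decidable P) {xs : List A} →
                AllPairs (λ x y → ¬ (P x × P y)) xs → ∑ xs (𝟙 ∘ P?) ≤ 1
∑-𝟙-exclusive {P = P} P? = ∑-exclusive (𝟙-≤1 ∘ P?) ∘ AllPairs.map split
  where
  split : ∀ {x y} → ¬ (P x × P y) → 𝟙 (P? x) ≡ 0 ⊎ 𝟙 (P? y) ≡ 0
  split {x} {y} ¬both with P? x
  ... | no  _  = inj₁ refl
  ... | yes px = inj₂ (𝟙-no (P? y) (λ py → ¬both (px , py)))

-- Averaging: if every term were at least `c`, so would be the mean.
∑-<⇒∃ : ∀ {A : Set} (xs : List A) (f : A → ℕ) {c} → ∑ xs f < length xs * c → ∃[ x ] x ∈ xs × f x < c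
∑-<⇒∃ (x ∷ xs) f {c} ∑< with f x <? c
... | yes fx<c = x , here refl , fx<c
... | no  fx≮c with ∑-<⇒∃ xs f (+-cancelˡ-< c _ _ (≤-<-trans (+-monoˡ-≤ _ (≮⇒≥ fx≮c)) ∑<))
...   | y , y∈xs , fy<c = y , there y∈xs , fy<c

length-filter : ∀ {A : Set} {P : A → Set} (P? : U.Decidable P) (xs : List A) →
                length (filter P? xs) ≡ ∑ xs (𝟙 ∘ P?)
length-filter P? []       = refl
length-filter P? (x ∷ xs) with P? x
... | yes _ = cong suc (length-filter P? xs)
... | no  _ = length-filter P? xs

length-concatMap : ∀ {A B : Set} (f : A → List B) (xs : List A) {c} → All (λ x → length (f x) ≤ c) xs →
                   length (concatMap f xs) ≤ length xs * c
length-concatMap f []       []          = z≤n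
length-concatMap f (x ∷ xs) (fx≤ ∷ fxs≤) =
  subst (_≤ _) (sym (length-++ (f x))) (+-mono-≤ fx≤ (length-concatMap f xs fxs≤))

-- Greedy choice from the end of the list: an element satisfying `Q` is kept unless one kept before
-- it is already `R`-related to it.
maximal-scattered : ∀ {A : Set} {Q : A → Set} {R : Rel A 0ℓ} → U.Decidable Q → Decidable R → (∀ x → R x x) →
  (xs : List A) → Σ[ ys ∈ List A ] All Q ys × AllPairs (λ x y → ¬ R y x) ys ×
                                  (∀ {x} → x ∈ xs → Q x → Any (λ y → R y x) ys)
maximal-scattered Q? R? R-refl [] = [] , [] , [] , λ ()
maximal-scattered {Q = Q} {R} Q? R? R-refl (x ∷ xs) with maximal-scattered Q? R? R-refl xs
... | ys , Qys , ys-scattered , dom with Q? x | Any.any? (λ y → R? y x) ys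
...   | no ¬Qx | _ = ys , Qys , ys-scattered , λ { (here refl) Qx → contradiction Qx ¬Qx ; (there x∈xs) → dom x∈xs }
...   | yes Qx | yes hit = ys , Qys , ys-scattered , λ { (here refl) _ → hit ; (there x∈xs) → dom x∈xs }
...   | yes Qx | no miss =
  x ∷ ys , Qx ∷ Qys , ¬Any⇒All¬ ys miss ∷ ys-scattered ,
  λ { (here refl) _ → here (R-refl x) ; (there x∈xs) Qz → there (dom x∈xs Qz) }

least : ∀ {n} {P : Fin n → Set} → U.Decidable P → ∃[ i ] P i → ∃[ i ] P i × (∀ j → P j → toℕ i ≤ toℕ j)
least {suc n} {P} P? (i , pi) with P? Fin.zero
... | yes p₀ = Fin.zero , p₀ , λ _ _ → z≤n
... | no ¬p₀ with least (P? ∘ Fin.suc) (tail i pi)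
  where
  tail : ∀ i → P i → ∃[ j ] P (Fin.suc j)
  tail Fin.zero    p₀ = contradiction p₀ ¬p₀
  tail (Fin.suc i) pi = i , pi
...   | j , pj , j-least = Fin.suc j , pj , λ { Fin.zero p₀ → contradiction p₀ ¬p₀ ; (Fin.suc i) pi → s≤s (j-least i pi) }

-- Truncated: the value is the bound when there is no witness below it.
μ : {P : ℕ → Set} → U.Decidable P → ℕ → ℕ
μ P? zero    = zero
μ P? (suc b) with P? zero
... | yes _ = zero
... | no  _ = suc (μ (P? ∘ suc) b)

μ-≤ : ∀ {P : ℕ → Set} (P? : U.Decidable P) b → μ P? b ≤ b
μ-≤ P? zero    = z≤n
μ-≤ P? (suc b) with P? zero
... | yes _ = z≤n
... | no  _ = s≤s (μ-≤ (P? ∘ suc) b)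

μ-sat : ∀ {P : ℕ → Set} (P? : U.Decidable P) b → μ P? b < b → P (μ P? b)
μ-sat P? (suc b) μ<b with P? zero
... | yes p₀ = p₀
... | no  _  = μ-sat (P? ∘ suc) b (≤-pred μ<b)

μ-least : ∀ {P : ℕ → Set} (P? : U.Decidable P) b {i} → P i → μ P? b ≤ i
μ-least P? zero    pi = z≤n
μ-least P? (suc b) {i} pi with P? zero | i
... | yes _  | _     = z≤n
... | no ¬p₀ | zero  = contradiction pi ¬p₀
... | no ¬p₀ | suc i = s≤s (μ-least (P? ∘ suc) b pi)

-- Parity

odd : ℕ → Bool
odd zero    = false
odd (suc n) = not (odd n)

odd-+ : ∀ m n → odd (m + n) ≡ odd m xor odd n
odd-+ zero    n = refl
odd-+ (suc m) n = trans (cong not (odd-+ m n)) (not-distribˡ-xor (odd m) (odd n))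

even-half : ∀ n → odd n ≡ false → ∃[ i ] 2 * i ≡ n
even-half zero          _    = 0 , refl
even-half (suc (suc n)) even with even-half n (trans (sym (not-involutive (odd n))) even)
... | i , refl = suc i , *-suc 2 i

-- Walks

data Walk {n} (R : Rel (Fin n) 0ℓ) : ℕ → Rel (Fin n) 0ℓ where
  []  : ∀ {u} → Walk R 0 u u
  _∷_ : ∀ {ℓ u v w} → R u v → Walk R ℓ v w → Walk R (suc ℓ) u w

module _ {n} {R : Rel (Fin n) 0ℓ} where

  walk? : Decidable R → ∀ ℓ → Decidable (Walk R ℓ)
  walk? R? zero u v with u Fin.≟ v
  ... | yes refl = yes []
  ... | no  u≢v  = no λ { [] → u≢v refl }
  walk? R? (suc ℓ) u v with Fin.any? (λ w → R? u w ×-dec walk? R? ℓ w v)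
  ... | yes (w , r , p) = yes (r ∷ p)
  ... | no  none        = no λ { (r ∷ p) → none (_ , r , p) }

  infixr 5 _⧺_
  _⧺_ : ∀ {ℓ ℓ′ u v w} → Walk R ℓ u v → Walk R ℓ′ v w → Walk R (ℓ + ℓ′) u w
  []      ⧺ q = q
  (r ∷ p) ⧺ q = r ∷ (p ⧺ q)

  _∷ʳ_ : ∀ {ℓ u v w} → Walk R ℓ u v → R v w → Walk R (suc ℓ) u w
  []      ∷ʳ s = s ∷ []
  (r ∷ p) ∷ʳ s = r ∷ (p ∷ʳ s)

  reverse : Symmetric R → ∀ {ℓ u v} → Walk R ℓ u v → Walk R ℓ v u
  reverse R-sym []      = []
  reverse R-sym (r ∷ p) = reverse R-sym p ∷ʳ R-sym r

  at : ∀ {ℓ u v} → Walk R ℓ u v → ℕ → Fin n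
  at {u = u} p       zero    = u
  at {u = u} []      (suc i) = u
  at         (r ∷ p) (suc i) = at p i

  at-end : ∀ {ℓ u v} (p : Walk R ℓ u v) → at p ℓ ≡ v
  at-end []      = refl
  at-end (r ∷ p) = at-end p

  at-step : ∀ {ℓ u v} (p : Walk R ℓ u v) {i} → i < ℓ → R (at p i) (at p (suc i))
  at-step (r ∷ [])    {zero} _         = r
  at-step (r ∷ s ∷ p) {zero} _         = r
  at-step (r ∷ p)     {suc i} (s≤s i<) = at-step p i<

  segment : ∀ {ℓ u v} (p : Walk R ℓ u v) i j → i + j ≤ ℓ → Walk R j (at p i) (at p (i + j))
  segment p i zero    _ = subst (λ z → Walk R 0 (at p i) (at p z)) (sym (+-identityʳ i)) []
  segment {ℓ} p i (suc j) i+j≤ℓ =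
    at-step p (≤-trans (s≤s (m≤m+n i j)) i+j<ℓ) ∷
    subst (λ z → Walk R j (at p (suc i)) (at p z)) (sym (+-suc i j)) (segment p (suc i) j i+j<ℓ)
    where i+j<ℓ = subst (_≤ ℓ) (+-suc i j) i+j≤ℓ

  -- The segment between two visits to the same vertex is closed, so it can be cut out.
  bypass : ∀ {ℓ u v} (p : Walk R ℓ u v) i j c → i + j + c ≡ ℓ → at p i ≡ at p (i + j) → Walk R (i + c) u v
  bypass p i j c refl eq =
    subst (Walk R i _) eq (segment p 0 i (≤-trans (m≤m+n i j) (m≤m+n (i + j) c))) ⧺
    subst (Walk R c _) (at-end p) (segment p (i + j) c ≤-refl)

  -- Pigeonhole: n + 1 visited vertices among n cannot be distinct.
  shorten : ∀ {u v} → Walk R n u v → ∃[ ℓ ] ℓ < n × Walk R ℓ u v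
  shorten p with Fin.pigeonhole (n<1+n n) (λ i → at p (toℕ i))
  ... | i , j , i<j , eq with m≤n⇒∃[o]m+o≡n (<⇒≤ i<j) | m≤n⇒∃[o]m+o≡n (≤-pred (Fin.toℕ<n j))
  ...   | d , i+d≡j | c , j+c≡n =
    toℕ i + c , subst (toℕ i + c <_) j+c≡n (+-monoˡ-< c i<j) ,
    bypass p (toℕ i) d c (trans (cong (_+ c) i+d≡j) j+c≡n) (trans eq (cong (at p) (sym i+d≡j)))

-- Odd closed walks

module _ (G : Graph) where
  open Graph G using (Adj; symm; irrefl)

  closedWalk⇒cycle : ∀ {ℓ v} (p : Walk Adj (3 + ℓ) v v) →
                     (∀ {i j : Fin (3 + ℓ)} → i Fin.< j → at p (toℕ i) ≢ at p (toℕ j)) → cycle3+ ℓ ⊑ G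
  closedWalk⇒cycle {ℓ} {v} p distinct = f , injective , adjacent
    where
    f : Fin (3 + ℓ) → Vertex G
    f i = at p (toℕ i)

    injective : ∀ {i j} → f i ≡ f j → i ≡ j
    injective {i} {j} eq with Fin.<-cmp i j
    ... | tri< i<j _ _ = contradiction eq (distinct i<j)
    ... | tri≈ _ i≡j _ = i≡j
    ... | tri> _ _ j<i = contradiction (sym eq) (distinct j<i)

    next-adjacent : ∀ i j → Next ℓ i j → Adj (f i) (f j)
    next-adjacent i j next with m≤n⇒m<n∨m≡n (Fin.toℕ<n i)
    ... | inj₁ lt = subst (λ z → Adj (f i) (at p z)) (sym (trans next (m<n⇒m%n≡m lt))) (at-step p (Fin.toℕ<n i))
    ... | inj₂ eq = subst (Adj (f i)) wrap (at-step p (Fin.toℕ<n i))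
      where
      wrap : at p (suc (toℕ i)) ≡ f j
      wrap = begin
        at p (suc (toℕ i)) ≡⟨ cong (at p) eq ⟩
        at p (3 + ℓ)       ≡⟨ at-end p ⟩
        at p 0             ≡⟨ cong (at p) (sym (trans next (trans (cong (_% (3 + ℓ)) eq) (n%n≡0 (3 + ℓ))))) ⟩
        f j                ∎
        where open ≡-Reasoning

    adjacent : ∀ {i j} → Next ℓ i j ⊎ Next ℓ j i → Adj (f i) (f j)
    adjacent {i} {j} (inj₁ next) = next-adjacent i j next
    adjacent {i} {j} (inj₂ next) = symm (next-adjacent j i next)

  -- A shortest odd closed walk repeats no vertex: a repetition splits it into two closed walks, one of them odd.
  no-odd-closed-walk : ∀ {k} → G IsFreeOf 𝒞[2 k -1] → ∀ {ℓ} → ℓ < 2 * k → odd ℓ ≡ true → ∀ {v} → ¬ Walk Adj ℓ v v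
  no-odd-closed-walk {k} free ℓ<2k ℓ-odd = go (<-wellFounded _) ℓ<2k ℓ-odd
    where
    embedded : ∀ {ℓ v} → ℓ < 2 * k → odd ℓ ≡ true → (p : Walk Adj ℓ v v) →
               ¬ (∀ {i j : Fin ℓ} → i Fin.< j → at p (toℕ i) ≢ at p (toℕ j))
    -- Lengths 0 and 2 are even and length 1 is a loop; what remains is `3 + ℓ` with `ℓ` even.
    embedded {1} ℓ<2k _ (e ∷ []) _ = irrefl refl e
    embedded {suc (suc (suc ℓ))} ℓ<2k ℓ-odd p distinct
      with even-half ℓ (subst (λ b → b ≡ false) (not-involutive (odd ℓ)) (not-injective ℓ-odd))
    ... | i , refl = All.lookup free (∈-map⁺ (λ i → cycle3+ (2 * i)) (∈-upTo⁺ i<k∸1)) (closedWalk⇒cycle p distinct)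
      where
      i<k∸1 : i < k ∸ 1
      i<k∸1 = m+n≤o⇒m≤o∸n (suc i) (subst (_≤ k) (+-comm 1 (suc i)) (*-cancelˡ-< 2 (suc i) k 2+2i<2k))
        where
        2+2i<2k : 2 * suc i < 2 * k
        2+2i<2k = subst (_< 2 * k) (sym (*-suc 2 i)) (<-trans (n<1+n _) ℓ<2k)

    go : ∀ {ℓ v} → Acc _<_ ℓ → ℓ < 2 * k → odd ℓ ≡ true → ¬ Walk Adj ℓ v v
    go {ℓ} {v} (acc rec) ℓ<2k ℓ-odd p
      with Fin.any? (λ (i : Fin ℓ) → Fin.any? (λ (j : Fin ℓ) → (i Fin.<? j) ×-dec (at p (toℕ i) Fin.≟ at p (toℕ j))))
    ... | no  none = embedded ℓ<2k ℓ-odd p (λ i<j eq → none (_ , _ , i<j , eq))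
    ... | yes (i , j , i<j , eq) with m≤n⇒∃[o]m+o≡n (<⇒≤ i<j) | m≤n⇒∃[o]m+o≡n (<⇒≤ (Fin.toℕ<n j))
    ...   | d , i+d≡j | c , j+c≡ℓ = case odd d ≟ᵇ true of λ where
        (yes d-odd) → go (rec d<ℓ) (<-trans d<ℓ ℓ<2k) d-odd loop
        (no  d-even) → go (rec i+c<ℓ) (<-trans i+c<ℓ ℓ<2k) (rest-odd (¬-not d-even)) (bypass p (toℕ i) d c total eq′)
      where
      total : toℕ i + d + c ≡ ℓ
      total = trans (cong (_+ c) i+d≡j) j+c≡ℓ

      eq′ : at p (toℕ i) ≡ at p (toℕ i + d)
      eq′ = trans eq (cong (at p) (sym i+d≡j))

      i+d<ℓ : toℕ i + d < ℓ
      i+d<ℓ = subst (_< ℓ) (sym i+d≡j) (Fin.toℕ<n j)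

      d<ℓ : d < ℓ
      d<ℓ = ≤-<-trans (m≤n+m d (toℕ i)) i+d<ℓ

      i+c<ℓ : toℕ i + c < ℓ
      i+c<ℓ = subst (toℕ i + c <_) j+c≡ℓ (+-monoˡ-< c i<j)

      loop : Walk Adj d (at p (toℕ i)) (at p (toℕ i))
      loop = subst (Walk Adj d _) (sym eq′) (segment p (toℕ i) d (<⇒≤ i+d<ℓ))

      rest-odd : odd d ≡ false → odd (toℕ i + c) ≡ true
      rest-odd d-even = begin
        odd (toℕ i + c)               ≡⟨ odd-+ (toℕ i) c ⟩
        odd (toℕ i) xor odd c         ≡⟨ cong (_xor odd c) (sym (xor-identityʳ (odd (toℕ i)))) ⟩
        (odd (toℕ i) xor false) xor odd c ≡⟨ cong (λ b → (odd (toℕ i) xor b) xor odd c) (sym d-even) ⟩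
        (odd (toℕ i) xor odd d) xor odd c ≡⟨ cong (_xor odd c) (sym (odd-+ (toℕ i) d)) ⟩
        odd (toℕ i + d) xor odd c     ≡⟨ sym (odd-+ (toℕ i + d) c) ⟩
        odd (toℕ i + d + c)           ≡⟨ cong odd total ⟩
        odd ℓ                         ≡⟨ ℓ-odd ⟩
        true                          ∎
        where open ≡-Reasoning

  -- Colourings

  -- The third colour goes to one φ-class of U and to those neighbours of U in that class whose
  -- ψ-colour would clash with the ψ-colour `true` that the other φ-class of U receives.
  three-colourable : {U S : Vertex G → Set} → U.Decidable U → U.Decidable S → (φ ψ : Vertex G → Bool) →
    (∀ {x} → U x → S x) → (∀ {x y} → U x → Adj x y → S y) →
    (∀ {x y} → S x → S y → Adj x y → φ x ≢ φ y) →
    (∀ {x y} → ¬ U x → ¬ U y → Adj x y → ψ x ≢ ψ y) → Colourable 3 G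
  three-colourable {U} {S} U? S? φ ψ U⊆S N[U]⊆S φ-proper ψ-proper = colour , proper
    where
    ψ′ : Vertex G → Bool
    ψ′ x = ⌊ U? x ⌋ ∨ ψ x

    ψ′-in : ∀ {x} → U x → ψ′ x ≡ true
    ψ′-in {x} ux with U? x
    ... | yes _  = refl
    ... | no ¬ux = contradiction ux ¬ux

    ψ′-out : ∀ {x} → ¬ U x → ψ′ x ≡ ψ x
    ψ′-out {x} ¬ux with U? x
    ... | yes ux = contradiction ux ¬ux
    ... | no _   = refl

    Third : Vertex G → Set
    Third x = S x × φ x ≡ true × ψ′ x ≡ true

    third? : U.Decidable Third
    third? x = S? x ×-dec ((φ x ≟ᵇ true) ×-dec (ψ′ x ≟ᵇ true))

    two : Bool → Fin 3
    two false = Fin.zero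
    two true  = Fin.suc Fin.zero

    two-injective : ∀ {b c} → two b ≡ two c → b ≡ c
    two-injective {false} {false} _ = refl
    two-injective {true}  {true}  _ = refl

    two≢2 : ∀ {b} → two b ≢ Fin.suc (Fin.suc Fin.zero)
    two≢2 {false} ()
    two≢2 {true}  ()

    colour : Vertex G → Fin 3
    colour x with third? x
    ... | yes _ = Fin.suc (Fin.suc Fin.zero)
    ... | no  _ = two (ψ′ x)

    -- Outside the third class, `ψ′ x ≡ true` forces `φ x ≡ false`. If `ψ′ y` agreed, `φ y` would be
    -- `false` too, although `φ` is proper on `S`.
    at-U : ∀ {x y} → U x → Adj x y → ¬ Third x → ¬ Third y → ψ′ x ≢ ψ′ y
    at-U {x} {y} ux xy ¬tx ¬ty eq = φ-proper sx sy xy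
      (trans (¬-not (λ φx → ¬tx (sx , φx , ψ′-in ux))) (sym (¬-not (λ φy → ¬ty (sy , φy , trans (sym eq) (ψ′-in ux))))))
      where
      sx = U⊆S ux
      sy = N[U]⊆S ux xy

    proper : ∀ {x y} → Adj x y → colour x ≢ colour y
    proper {x} {y} xy eq with third? x | third? y
    ... | yes (sx , φx , _) | yes (sy , φy , _) = φ-proper sx sy xy (trans φx (sym φy))
    ... | yes _  | no _   = two≢2 (sym eq)
    ... | no _   | yes _  = two≢2 eq
    ... | no ¬tx | no ¬ty = clash (U? x) (U? y) (two-injective eq)
      where
      clash : Dec (U x) → Dec (U y) → ψ′ x ≢ ψ′ y
      clash (yes ux) _        = at-U ux xy ¬tx ¬ty
      clash (no ¬ux) (yes uy) = at-U uy (symm xy) ¬ty ¬tx ∘ sym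
      clash (no ¬ux) (no ¬uy) eq = ψ-proper ¬ux ¬uy xy (trans (sym (ψ′-out ¬ux)) (trans eq (ψ′-out ¬uy)))

-- Two-colourings by parity in a graph of large odd girth

module OddGirth (G : Graph) (k : ℕ)
  (no-odd : ∀ {ℓ} → ℓ < 2 * k → odd ℓ ≡ true → ∀ {v} → ¬ Walk (Graph.Adj G) ℓ v v) where
  open Graph G using (Adj; adj?; symm)

  -- Both walks and the edge close up to a walk of length `ℓ + ℓ′ + 1 < 2k`, which is odd when the
  -- parities agree.
  parity-changes : ∀ {ℓ ℓ′ c x y} → ℓ < k → ℓ′ < k → Walk Adj ℓ c x → Walk Adj ℓ′ c y → Adj x y → odd ℓ ≢ odd ℓ′
  parity-changes {ℓ} {ℓ′} ℓ<k ℓ′<k p q xy eq = no-odd bound is-odd (p ⧺ (xy ∷ reverse symm q))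
    where
    bound : ℓ + suc ℓ′ < 2 * k
    bound = subst (ℓ + suc ℓ′ <_) (cong (_+_ k) (sym (+-identityʳ k))) (+-mono-<-≤ ℓ<k ℓ′<k)

    is-odd : odd (ℓ + suc ℓ′) ≡ true
    is-odd = trans (odd-+ ℓ (suc ℓ′)) (subst (λ b → b xor not (odd ℓ′) ≡ true) (sym eq) (xor-not (odd ℓ′)))
      where
      xor-not : ∀ b → b xor not b ≡ true
      xor-not false = refl
      xor-not true  = refl

  -- Within `S`, each `C j` is a union of components. Every vertex takes the parity of some walk
  -- from the centre of least index containing it; adjacent vertices use the same centre, and
  -- `parity-changes` applies whichever short walks are taken.
  two-colourable : ∀ {N} {C : Fin N → Vertex G → Set} {S : Vertex G → Set} (c : Fin N → Vertex G) →
    Decidable C → (∀ {j x} → C j x → ∃[ ℓ ] ℓ < k × Walk Adj ℓ (c j) x) →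
    (∀ {x} → S x → ∃[ j ] C j x) → (∀ {j x y} → S x → S y → Adj x y → C j x → C j y) →
    Σ[ φ ∈ (Vertex G → Bool) ] (∀ {x y} → S x → S y → Adj x y → φ x ≢ φ y)
  two-colourable {C = C} {S} c C? ball cover closed = φ , proper
    where
    len : ∀ {x} → ∃[ j ] C j x → ℕ
    len e = proj₁ (ball (proj₁ (proj₂ (least (λ j → C? j _) e))))

    φ : Vertex G → Bool
    φ x with Fin.any? (λ j → C? j x)
    ... | yes e = odd (len e)
    ... | no  _ = false

    len-proper : ∀ {x y} → S x → S y → Adj x y → (e : ∃[ j ] C j x) (e′ : ∃[ j ] C j y) → odd (len e) ≢ odd (len e′)
    len-proper sx sy xy e e′ with least (λ j → C? j _) e | least (λ j → C? j _) e′
    ... | i , cx , i-least | j , cy , j-least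
      -- Closedness in both directions along the edge makes the two least indices equal.
      with Fin.toℕ-injective (≤-antisym (i-least j (closed sy sx (symm xy) cy)) (j-least i (closed sx sy xy cx)))
    ...   | refl with ball cx | ball cy
    ...     | ℓ , ℓ<k , p | ℓ′ , ℓ′<k , q = parity-changes ℓ<k ℓ′<k p q xy

    proper : ∀ {x y} → S x → S y → Adj x y → φ x ≢ φ y
    proper {x} {y} sx sy xy with Fin.any? (λ j → C? j x) | Fin.any? (λ j → C? j y)
    ... | yes e | yes e′ = len-proper sx sy xy e e′
    ... | no ¬e | _      = contradiction (cover sx) ¬e
    ... | yes _ | no ¬e′ = contradiction (cover sy) ¬e′

  -- Distance truncated at k.
  dist : Vertex G → Vertex G → ℕ
  dist u x = μ (λ ℓ → walk? adj? ℓ u x) k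

  dist-walk : ∀ {u x} → dist u x < k → Walk Adj (dist u x) u x
  dist-walk = μ-sat _ k

  walk-dist : ∀ {ℓ u x} → Walk Adj ℓ u x → dist u x ≤ ℓ
  walk-dist = μ-least _ k

  dist-step : ∀ {u x y} → Adj x y → dist u y ≤ suc (dist u x)
  dist-step {u} {x} xy with dist u x <? k
  ... | yes d<k = walk-dist (dist-walk d<k ∷ʳ xy)
  -- Here `dist u x` has the truncation value `k`, which bounds `dist u y`.
  ... | no  d≮k = ≤-trans (μ-≤ _ k) (m≤n⇒m≤1+n (≮⇒≥ d≮k))

  -- Below `k` no edge lies within a level, since its ends would have walks of equal parity from
  -- `u`. So an edge changes the level by exactly one.
  dist-adjacent : ∀ {u x y} → Adj x y → dist u x < k → dist u y ≡ suc (dist u x) ⊎ dist u x ≡ suc (dist u y)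
  dist-adjacent {u} {x} {y} xy d<k with <-cmp (dist u x) (dist u y)
  ... | tri< x<y _ _ = inj₁ (≤-antisym (dist-step xy) x<y)
  ... | tri> _ _ y<x = inj₂ (≤-antisym (dist-step (symm xy)) y<x)
  ... | tri≈ _ eq _  = contradiction (cong odd eq)
                         (parity-changes d<k y<k (dist-walk d<k) (dist-walk y<k) xy)
    where y<k = subst (_< k) eq d<k

  -- The components of an auxiliary graph on Q, joining points at distance at most 7, have
  -- diameter less than |Q|, so they stay within the radius in which parity is well defined.
  two-colourable-near : ∀ (Q : List (Vertex G)) → 7 * length Q + 3 < k → {S : Vertex G → Set} →
    (∀ {x} → S x → Any (λ p → dist p x ≤ 3) Q) →
    Σ[ φ ∈ (Vertex G → Bool) ] (∀ {x y} → S x → S y → Adj x y → φ x ≢ φ y)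
  two-colourable-near Q 7Q+3<k {S} near = two-colourable c C? ball cover closed
    where
    N = length Q

    c : Fin N → Vertex G
    c = lookup Q

    Link : Rel (Fin N) 0ℓ
    Link a b = dist (c a) (c b) ≤ 7

    -- Reachability by links; the bound on the length makes it decidable, and `shorten` keeps it
    -- closed under adding a link.
    Linked : Rel (Fin N) 0ℓ
    Linked j a = ∃[ i ] Walk Link (toℕ {N} i) j a

    linked? : Decidable Linked
    linked? j a = Fin.any? (λ i → walk? (λ a b → dist (c a) (c b) ≤? 7) (toℕ i) j a)

    C : Fin N → Vertex G → Set
    C j x = ∃[ a ] Linked j a × dist (c a) x ≤ 3

    C? : Decidable C
    C? j x = Fin.any? (λ a → linked? j a ×-dec (dist (c a) x ≤? 3))

    3<k : 3 < k
    3<k = ≤-<-trans (m≤n+m 3 (7 * N)) 7Q+3<k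

    7<k : Fin N → 7 < k
    7<k a = ≤-<-trans (≤-trans (*-monoʳ-≤ 7 (≤-<-trans z≤n (Fin.toℕ<n a))) (m≤m+n (7 * N) 3)) 7Q+3<k

    extend : ∀ {j a b} → Linked j a → Link a b → Linked j b
    extend {j} {a} {b} (i , p) ab with suc (toℕ i) <? N
    ... | yes i<N = fromℕ< i<N , subst (λ ℓ → Walk Link ℓ j b) (sym (Fin.toℕ-fromℕ< i<N)) (p ∷ʳ ab)
    ... | no  i≮N with shorten (subst (λ ℓ → Walk Link ℓ j b) (≤-antisym (Fin.toℕ<n i) (≮⇒≥ i≮N)) (p ∷ʳ ab))
    ...   | ℓ , ℓ<N , q = fromℕ< ℓ<N , subst (λ ℓ → Walk Link ℓ j b) (sym (Fin.toℕ-fromℕ< ℓ<N)) q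

    unfold : ∀ {ℓ j a} → Walk Link ℓ j a → ∃[ ℓ′ ] ℓ′ ≤ 7 * ℓ × Walk Adj ℓ′ (c j) (c a)
    unfold [] = 0 , z≤n , []
    unfold {suc ℓ} {j} (s ∷ p) with unfold p
    ... | ℓ′ , ℓ′≤ , q = _ , ≤-trans (+-mono-≤ s ℓ′≤) (≤-reflexive (sym (*-suc 7 ℓ))) , dist-walk (≤-<-trans s (7<k j)) ⧺ q

    ball : ∀ {j x} → C j x → ∃[ ℓ ] ℓ < k × Walk Adj ℓ (c j) x
    ball (a , (i , p) , a≤3) with unfold p
    ... | ℓ , ℓ≤ , q =
      _ , ≤-<-trans (+-mono-≤ (≤-trans ℓ≤ (*-monoʳ-≤ 7 (<⇒≤ (Fin.toℕ<n i)))) a≤3) 7Q+3<k , q ⧺ dist-walk (≤-<-trans a≤3 3<k)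

    nearest : ∀ {x} → S x → ∃[ a ] dist (c a) x ≤ 3
    nearest sx = Any.index (near sx) , lookup-index (near sx)

    cover : ∀ {x} → S x → ∃[ j ] C j x
    cover sx with nearest sx
    ... | a , a≤3 = a , a , (fromℕ< 0<N , subst (λ ℓ → Walk Link ℓ a a) (sym (Fin.toℕ-fromℕ< 0<N)) []) , a≤3
      where 0<N = ≤-<-trans z≤n (Fin.toℕ<n a)

    closed : ∀ {j x y} → S x → S y → Adj x y → C j x → C j y
    closed sx sy xy (a , ja , a≤3) with nearest sy
    ... | b , b≤3 = b , extend ja ab , b≤3
      where
      -- The 7 in `Link`: at most 3 steps to `x`, the edge `xy`, and at most 3 steps from `y`.
      ab : Link a b
      ab = ≤-trans (walk-dist (dist-walk (≤-<-trans a≤3 3<k) ⧺ (xy ∷ reverse symm (dist-walk (≤-<-trans b≤3 3<k)))))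
                   (+-mono-≤ a≤3 (s≤s b≤3))

-- Levels two steps apart and the choice of scales

-- The levels that two steps can reach from level `i` when each step changes the level by one.
Near : Rel ℕ 0ℓ
Near i e = e ≡ i ⊎ e ≡ 2 + i ⊎ i ≡ 2 + e

near? : Decidable Near
near? i e = (e ≟ i) ⊎-dec ((e ≟ 2 + i) ⊎-dec (i ≟ 2 + e))

-- For fixed `e`, each of the three alternatives determines `i`.
∑-near : ∀ {is} → Unique is → ∀ e → ∑ is (λ i → 𝟙 (near? i e)) ≤ 3
∑-near {is} uniq e = begin
  ∑ is (λ i → 𝟙 (near? i e))                                  ≤⟨ ∑-mono is split ⟩
  ∑ is (λ i → 𝟙 (e ≟ i) + (𝟙 (e ≟ 2 + i) + 𝟙 (i ≟ 2 + e)))    ≡⟨ ∑-+ is _ _ ⟩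
  ∑ is (λ i → 𝟙 (e ≟ i)) + ∑ is (λ i → 𝟙 (e ≟ 2 + i) + 𝟙 (i ≟ 2 + e))
    ≡⟨ cong (∑ is (λ i → 𝟙 (e ≟ i)) +_) (∑-+ is _ _) ⟩
  ∑ is (λ i → 𝟙 (e ≟ i)) + (∑ is (λ i → 𝟙 (e ≟ 2 + i)) + ∑ is (λ i → 𝟙 (i ≟ 2 + e)))
    ≤⟨ +-mono-≤ (once (e ≟_) (λ p q → trans (sym p) q))
      (+-mono-≤ (once (λ i → e ≟ 2 + i) (λ p q → +-cancelˡ-≡ 2 _ _ (trans (sym p) q)))
                (once (λ i → i ≟ 2 + e) (λ p q → trans p (sym q)))) ⟩
  3 ∎
  where
  open ≤-Reasoning

  split : ∀ i → 𝟙 (near? i e) ≤ 𝟙 (e ≟ i) + (𝟙 (e ≟ 2 + i) + 𝟙 (i ≟ 2 + e))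
  split i with near? i e
  ... | no _                  = z≤n
  ... | yes (inj₁ p)          = ≤-trans (𝟙-yes (e ≟ i) p) (m≤m+n _ _)
  ... | yes (inj₂ (inj₁ p))   = ≤-trans (≤-trans (𝟙-yes (e ≟ 2 + i) p) (m≤m+n _ _)) (m≤n+m _ (𝟙 (e ≟ i)))
  ... | yes (inj₂ (inj₂ p))   = ≤-trans (≤-trans (𝟙-yes (i ≟ 2 + e) p) (m≤n+m _ (𝟙 (e ≟ 2 + i)))) (m≤n+m _ (𝟙 (e ≟ i)))

  once : ∀ {P : ℕ → Set} (P? : U.Decidable P) → (∀ {i j} → P i → P j → i ≡ j) → ∑ is (𝟙 ∘ P?) ≤ 1
  once P? P-unique = ∑-𝟙-exclusive P? (AllPairs.map (λ i≢j (pi , pj) → i≢j (P-unique pi pj)) uniq)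

-- h is the inner radius used to bound the number of centres, L the number of candidate radii for a
-- sphere; 735 = 49 · 15 bounds the number of points of the packing near the chosen spheres.
record Scales (k m : ℕ) : Set where
  field
    h L       : ℕ
    split     : L + (2 * h + 4) ≡ k
    many      : m * 3 < L * 16
    few       : m * 3 < 50 * h
    short     : 7 * 735 + 3 < k

-- With `h` about `k/8`, `L` is about `3k/4`. As `3m` is at most `273k/45`, roughly `6.07k`, it
-- stays below `50h`, roughly `6.25k`, and well below `16L`, roughly `12k`.
scales : ∀ {k m} → 5490 ≤ k → 45 * m ≤ 91 * k → Scales k m
scales {k} {m} k≥ 45m≤ = record
  { h     = h
  ; L     = L
  ; split = split
  ; many  = *-cancelˡ-< 45 _ _ (≤-<-trans 45*3m≤ 273k<)
  ; few   = *-cancelˡ-< 45 _ _ (≤-<-trans 45*3m≤ 273k<′)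
  ; short = ≤-trans (m≤m+n 5149 341) k≥
  }
  where
  open ≤-Reasoning
  h = k ℕ./ 8
  L = k ∸ (2 * h + 4)

  8h≤k : h * 8 ≤ k
  8h≤k = m/n*n≤m k 8

  k≤8h+7 : k ≤ 7 + h * 8
  k≤8h+7 = begin
    k                ≡⟨ m≡m%n+[m/n]*n k 8 ⟩
    k % 8 + h * 8    ≤⟨ +-monoˡ-≤ (h * 8) (≤-pred (m%n<n k 8)) ⟩
    7 + h * 8        ∎

  30≤h : 30 ≤ h
  30≤h = ≤-trans (m≤m+n 30 656) (/-monoˡ-≤ 8 k≥)

  2h+4≤k : 2 * h + 4 ≤ k
  2h+4≤k = begin
    2 * h + 4       ≤⟨ +-monoʳ-≤ (2 * h) (≤-trans (m≤m+n 4 26) 30≤h) ⟩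
    2 * h + h       ≡⟨ solve 1 (λ h → con 2 :* h :+ h := h :* con 3) refl h ⟩
    h * 3           ≤⟨ *-monoʳ-≤ h (m≤m+n 3 5) ⟩
    h * 8           ≤⟨ 8h≤k ⟩
    k               ∎

  split : L + (2 * h + 4) ≡ k
  split = m∸n+n≡m 2h+4≤k

  45*3m≤ : 45 * (m * 3) ≤ 273 * k
  45*3m≤ = begin
    45 * (m * 3)  ≡⟨ solve 1 (λ m → con 45 :* (m :* con 3) := con 3 :* (con 45 :* m)) refl m ⟩
    3 * (45 * m)  ≤⟨ *-monoʳ-≤ 3 45m≤ ⟩
    3 * (91 * k)  ≡⟨ sym (*-assoc 3 91 k) ⟩
    273 * k       ∎

  273k< : 273 * k < 45 * (L * 16)
  -- Adding `720 * (2 * h + 4)` on both sides turns the truncated subtraction in `L` into `split`.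
  273k< = +-cancelʳ-< (720 * (2 * h + 4)) _ _ (begin-strict
    273 * k + 720 * (2 * h + 4)          ≡⟨ solve 2 (λ k h →
      con 273 :* k :+ con 720 :* (con 2 :* h :+ con 4) := con 273 :* k :+ con 180 :* (h :* con 8) :+ con 2880) refl k h ⟩
    273 * k + 180 * (h * 8) + 2880       <⟨ +-mono-≤-< (+-monoʳ-≤ (273 * k) (*-monoʳ-≤ 180 8h≤k)) (≤-trans (m≤m+n 2881 2609) k≥) ⟩
    273 * k + 180 * k + k                ≡⟨ solve 1 (λ k → con 273 :* k :+ con 180 :* k :+ k := con 454 :* k) refl k ⟩
    454 * k                              ≤⟨ *-monoˡ-≤ k (m≤m+n 454 266) ⟩
    720 * k                              ≡⟨ cong (720 *_) (sym split) ⟩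
    720 * (L + (2 * h + 4))              ≡⟨ solve 2 (λ L c →
      con 720 :* (L :+ c) := con 45 :* (L :* con 16) :+ con 720 :* c) refl L (2 * h + 4) ⟩
    45 * (L * 16) + 720 * (2 * h + 4)    ∎)

  273k<′ : 273 * k < 45 * (50 * h)
  273k<′ = begin-strict
    273 * k              ≤⟨ *-monoʳ-≤ 273 k≤8h+7 ⟩
    273 * (7 + h * 8)    ≡⟨ solve 1 (λ h → con 273 :* (con 7 :+ h :* con 8) := con 1911 :+ con 2184 :* h) refl h ⟩
    -- Since 45 · 50 = 2184 + 66, a surplus of `66 * h` absorbs the rounding error 273 · 7.
    1911 + 2184 * h      <⟨ +-monoˡ-< (2184 * h) (≤-trans (m≤m+n 1912 68) (*-monoʳ-≤ 66 30≤h)) ⟩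
    66 * h + 2184 * h    ≡⟨ solve 1 (λ h → con 66 :* h :+ con 2184 :* h := con 45 :* (con 50 :* h)) refl h ⟩
    45 * (50 * h)        ∎

-- Packing of disjoint neighbourhoods

module DenseOddGirth (G : Graph) (k : ℕ)
  (no-odd : ∀ {ℓ} → ℓ < 2 * k → odd ℓ ≡ true → ∀ {v} → ¬ Walk (Graph.Adj G) ℓ v v)
  (m δ : ℕ) (δ≤degree : ∀ v → suc δ ≤ Graph.degree G v) (dense : order G ≤ m * suc δ) (sc : Scales k m) where

  open Graph G using (Adj; adj?; symm; degree)
  open OddGirth G k no-odd
  open Scales sc

  n = order G

  dist-refl : ∀ v → dist v v ≡ 0
  dist-refl v = n≤0⇒n≡0 (walk-dist [])

  -- Two applications of `dist-adjacent`; the bound on `x` keeps the middle vertex below `k`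
  -- whenever the second one needs it.
  meet-near : ∀ {u x p} → suc (dist u x) < k → Walk Adj 2 x p → Near (dist u x) (dist u p)
  meet-near {u} {x} {p} x<k (_∷_ {v = y} xy (yp ∷ [])) with dist-adjacent xy (<-trans (n<1+n _) x<k)
  ... | inj₁ eq with dist-adjacent {u} yp (subst (_< k) (sym eq) x<k)
  ...   | inj₁ eq′ = inj₂ (inj₁ (trans eq′ (cong suc eq)))
  ...   | inj₂ eq′ = inj₁ (suc-injective (trans (sym eq′) eq))
  meet-near {u} {x} {p} x<k (_∷_ {v = y} xy (yp ∷ [])) | inj₂ eq
    with dist-adjacent {u} yp (<-trans (subst (dist u y <_) (sym eq) (n<1+n _)) (<-trans (n<1+n _) x<k))
  ...   | inj₁ eq′ = inj₁ (trans eq′ (sym eq))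
  ...   | inj₂ eq′ = inj₂ (inj₂ (trans eq (cong suc eq′)))

  -- Positive degree provides a neighbour to visit and return from.
  meet-refl : ∀ x → Walk Adj 2 x x
  meet-refl x with filter (adj? x) (allFin n) in eq
  ... | [] = contradiction (subst (λ xs → suc δ ≤ length xs) eq (δ≤degree x)) λ ()
  ... | y ∷ _ = xy ∷ (symm xy ∷ [])
    where
    xy : Adj x y
    xy = proj₂ (∈-filter⁻ (adj? x) {xs = allFin n} (subst (y ∈_) (sym eq) (here refl)))

  abstract
    packing : Σ[ ps ∈ List (Vertex G) ] All (λ _ → ⊤) ps × AllPairs (λ x y → ¬ Walk Adj 2 y x) ps ×
                                       (∀ {x} → x ∈ allFin n → ⊤ → Any (λ p → Walk Adj 2 p x) ps)
    packing = maximal-scattered {Q = λ _ → ⊤} (λ _ → yes tt) (walk? adj? 2) meet-refl (allFin n)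

  P : List (Vertex G)
  P = proj₁ packing

  P-dominates : ∀ x → Any (λ p → Walk Adj 2 p x) P
  P-dominates x = proj₂ (proj₂ (proj₂ packing)) (∈-allFin x) tt

  -- The points of `P` have disjoint neighbourhoods, each of at least `suc δ` vertices, among at
  -- most `m * suc δ`.
  length-P : length P ≤ m
  length-P = *-cancelʳ-≤ (length P) m (suc δ) (begin
    length P * suc δ                                     ≤⟨ *-≤∑ (All.universal δ≤degree P) ⟩
    ∑ P degree                                           ≤⟨ ∑-mono P (λ p → ≤-reflexive (length-filter (adj? p) (allFin n))) ⟩
    ∑ P (λ p → ∑ (allFin n) (λ x → 𝟙 (adj? p x)))        ≡⟨ ∑-swap P (allFin n) _ ⟩
    ∑ (allFin n) (λ x → ∑ P (λ p → 𝟙 (adj? p x)))        ≤⟨ ∑-≤* (allFin n) disjoint ⟩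
    length (allFin n) * 1                                ≡⟨ trans (*-identityʳ _) (length-tabulate (λ i → i)) ⟩
    n                                                    ≤⟨ dense ⟩
    m * suc δ                                            ∎)
    where
    open ≤-Reasoning
    disjoint : ∀ x → ∑ P (λ p → 𝟙 (adj? p x)) ≤ 1
    disjoint x = ∑-𝟙-exclusive (λ p → adj? p x)
      (AllPairs.map (λ ¬meet (px , qx) → ¬meet (qx ∷ (symm px ∷ []))) (proj₁ (proj₂ (proj₂ packing))))

  -- Spheres meeting few packing points

  -- If `suc i < k`, this contains every point of `P` sharing a neighbour with the sphere of radius
  -- `i` around `v`, by `meet-near`.
  layer : Vertex G → ℕ → List (Vertex G)
  layer v i = filter (λ p → near? i (dist v p)) P

  layer-swap : ∀ v is → ∑ is (length ∘ layer v) ≤ ∑ P (λ p → ∑ is (λ i → 𝟙 (near? i (dist v p))))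
  layer-swap v is = ≤-trans (∑-mono is (λ i → ≤-reflexive (length-filter (λ p → near? i (dist v p)) P)))
                            (≤-reflexive (∑-swap is P _))

  -- Centres more than `r` apart have disjoint balls of radius `h + 1`.
  r : ℕ
  r = 2 * h + 2

  -- The radii from `r + 1` to `r + L`, where `r + L` equals `k - 2`.
  radii : List ℕ
  radii = map (suc r +_) (upTo L)

  abstract
    -- Each point of `P` lies in at most three layers, so the `L` layers have total size at most
    -- `3m < 16L`.
    good-radius : ∀ v → ∃[ i ] r < i × suc i < k × length (layer v i) < 16
    good-radius v with ∑-<⇒∃ radii (length ∘ layer v) ∑<
      where
      ∑< : ∑ radii (length ∘ layer v) < length radii * 16
      ∑< = begin-strict
        ∑ radii (length ∘ layer v)                                ≤⟨ layer-swap v radii ⟩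
        ∑ P (λ p → ∑ radii (λ i → 𝟙 (near? i (dist v p))))
          ≤⟨ ∑-≤* P (λ p → ∑-near (Unique.map⁺ (+-cancelˡ-≡ (suc r) _ _) (Unique.upTo⁺ L)) (dist v p)) ⟩
        length P * 3                                              ≤⟨ *-monoˡ-≤ 3 length-P ⟩
        m * 3                                                     <⟨ many ⟩
        L * 16                                                    ≡⟨ cong (_* 16) (sym (trans (length-map (suc r +_) (upTo L)) (length-upTo L))) ⟩
        length radii * 16                                         ∎
        where open ≤-Reasoning
    ... | i , i∈ , small with ∈-map⁻ (suc r +_) {xs = upTo L} i∈
    ...   | j , j∈ , refl = suc r + j , s≤s (m≤m+n r j) , bound , small
      where
      bound : suc (suc r + j) < k
      bound = begin-strict
        suc (suc r + j)   ≡⟨ solve 2 (λ h j → con 2 :+ (con 2 :* h :+ con 2 :+ j) := j :+ (con 2 :* h :+ con 4)) refl h j ⟩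
        j + (2 * h + 4)   <⟨ +-monoˡ-< _ (∈-upTo⁻ {L} j∈) ⟩
        L + (2 * h + 4)   ≡⟨ split ⟩
        k                 ∎
        where open ≤-Reasoning

  radius : Vertex G → ℕ
  radius v = proj₁ (good-radius v)

  r<radius : ∀ v → r < radius v
  r<radius v = proj₁ (proj₂ (good-radius v))

  radius<k : ∀ v → suc (radius v) < k
  radius<k v = proj₁ (proj₂ (proj₂ (good-radius v)))

  -- A vertex that is not rich has a small component, which needs no cut.
  Rich : Vertex G → Set
  Rich v = ∀ (j : Fin h) → ∃[ x ] dist v x ≡ toℕ j

  rich-at? : ∀ v (j : Fin h) → Dec (∃[ x ] dist v x ≡ toℕ j)
  rich-at? v j = Fin.any? (λ x → dist v x ≟ toℕ j)

  rich? : U.Decidable Rich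
  rich? v = Fin.all? (rich-at? v)

  -- The net of centres

  abstract
    net : Σ[ vs ∈ List (Vertex G) ] All Rich vs × AllPairs (λ x y → ¬ dist y x ≤ r) vs ×
                                   (∀ {x} → x ∈ allFin n → Rich x → Any (λ v → dist v x ≤ r) vs)
    net = maximal-scattered rich? (λ v x → dist v x ≤? r) (λ v → ≤-trans (≤-reflexive (dist-refl v)) z≤n) (allFin n)

  centres : List (Vertex G)
  centres = proj₁ net

  h+2≤k : h + 2 ≤ k
  h+2≤k = begin
    h + 2           ≤⟨ +-mono-≤ (m≤m+n h _) (m≤m+n 2 2) ⟩
    2 * h + 4       ≤⟨ m≤n+m _ L ⟩
    L + (2 * h + 4) ≡⟨ split ⟩
    k               ∎
    where open ≤-Reasoning

  -- Count triples of a centre, a point of `P` and a level below `h` near it. A rich centre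
  -- contributes at least `h`; a point of `P` contributes at most 3, all from one centre. Hence the
  -- number of centres times `h` is at most `3m < 50h`.
  length-centres : length centres ≤ 49
  length-centres = ≤-pred (*-cancelʳ-< h (length centres) 50 (begin-strict
    length centres * h                            ≤⟨ *-≤∑ (All.map populated (proj₁ (proj₂ net))) ⟩
    ∑ centres (λ v → ∑ P (g v))                   ≡⟨ ∑-swap centres P g ⟩
    ∑ P (λ p → ∑ centres (λ v → g v p))
      ≤⟨ ∑-≤* P (λ p → ∑-exclusive (λ v → ∑-near (Unique.upTo⁺ h) (dist v p))
                                   (AllPairs.map (separated p) (proj₁ (proj₂ (proj₂ net))))) ⟩
    length P * 3                                  ≤⟨ *-monoˡ-≤ 3 length-P ⟩
    m * 3                                         <⟨ few ⟩
    50 * h                                        ∎))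
    where
    open ≤-Reasoning
    g : Vertex G → Vertex G → ℕ
    g v p = ∑ (upTo h) (λ j → 𝟙 (near? j (dist v p)))

    hit : ∀ {v} → Rich v → ∀ {j} → j < h → 1 ≤ length (layer v j)
    hit {v} rich {j} j<h with rich (fromℕ< j<h)
    ... | x , eq with find (P-dominates x)
    ...   | p , p∈P , px = nonempty (∈-filter⁺ (λ p → near? j (dist v p)) p∈P
      (subst (λ z → Near z (dist v p)) x≡j (meet-near x<k (reverse symm px))))
      where
      x≡j : dist v x ≡ j
      x≡j = trans eq (Fin.toℕ-fromℕ< j<h)
      x<k : suc (dist v x) < k
      x<k = subst (λ z → suc z < k) (sym x≡j) (≤-trans (s≤s (s≤s (<⇒≤ j<h))) (subst (_≤ k) (+-comm h 2) h+2≤k))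
      nonempty : ∀ {y : Vertex G} {ys} → y ∈ ys → 1 ≤ length ys
      nonempty (here _)  = s≤s z≤n
      nonempty (there _) = s≤s z≤n

    populated : ∀ {v} → Rich v → h ≤ ∑ P (g v)
    populated {v} rich = begin
      h                               ≡⟨ sym (trans (*-identityʳ _) (length-upTo h)) ⟩
      length (upTo h) * 1             ≤⟨ *-≤∑ (All.tabulate (λ j∈ → hit rich (∈-upTo⁻ {h} j∈))) ⟩
      ∑ (upTo h) (length ∘ layer v)   ≤⟨ layer-swap v (upTo h) ⟩
      ∑ P (g v)                       ∎

    far : ∀ {v p} → ¬ dist v p < h + 2 → g v p ≡ 0
    far {v} {p} ≮ = ∑-zero (All.tabulate (λ {j} j∈ → 𝟙-no (near? j (dist v p)) (¬near (∈-upTo⁻ {h} j∈))))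
      where
      ¬near : ∀ {j} → j < h → ¬ Near j (dist v p)
      ¬near j<h (inj₁ eq)        = ≮ (subst (_< h + 2) (sym eq) (≤-trans j<h (m≤m+n h 2)))
      ¬near {j} j<h (inj₂ (inj₁ eq)) = ≮ (subst (_< h + 2) (sym (trans eq (+-comm 2 j))) (+-monoˡ-< 2 j<h))
      ¬near j<h (inj₂ (inj₂ eq)) = ≮ (≤-trans (≤-trans (m≤n+m _ 2) (subst (_< h) eq j<h)) (m≤m+n h 2))

    -- A point counted for both centres is within `h + 1` of each, putting them within `r` of each
    -- other.
    separated : ∀ p {a b} → ¬ dist b a ≤ r → g a p ≡ 0 ⊎ g b p ≡ 0
    separated p {a} {b} ¬ba with dist a p <? h + 2 | dist b p <? h + 2
    ... | no a≮ | _     = inj₁ (far a≮)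
    ... | _     | no b≮ = inj₂ (far b≮)
    ... | yes a< | yes b< = contradiction (≤-trans (walk-dist b⟶a) sum≤) ¬ba
      where
      b⟶a : Walk Adj (dist b p + dist a p) b a
      b⟶a = dist-walk (≤-trans b< h+2≤k) ⧺ reverse symm (dist-walk (≤-trans a< h+2≤k))

      h+2≤ : h + 2 ≤ suc (h + 1)
      h+2≤ = ≤-reflexive (+-suc h 1)

      sum≤ : dist b p + dist a p ≤ r
      sum≤ = begin
        dist b p + dist a p ≤⟨ +-mono-≤ (≤-pred (≤-trans b< h+2≤)) (≤-pred (≤-trans a< h+2≤)) ⟩
        (h + 1) + (h + 1)   ≡⟨ solve 1 (λ h → h :+ con 1 :+ (h :+ con 1) := con 2 :* h :+ con 2) refl h ⟩
        r                   ∎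

  -- The cut and the two colourings

  Cut : Vertex G → Set
  Cut x = Any (λ v → dist v x ≡ radius v) centres

  cut? : U.Decidable Cut
  cut? x = Any.any? (λ v → dist v x ≟ radius v) centres

  N[Cut] : Vertex G → Set
  N[Cut] x = Cut x ⊎ (∃[ y ] Cut y × Adj y x)

  N[cut]? : U.Decidable N[Cut]
  N[cut]? x = cut? x ⊎-dec Fin.any? (λ y → cut? y ×-dec adj? y x)

  Q : List (Vertex G)
  Q = concatMap (λ v → layer v (radius v)) centres

  7Q+3<k : 7 * length Q + 3 < k
  7Q+3<k = ≤-<-trans (+-monoˡ-≤ 3 (*-monoʳ-≤ 7 length-Q)) short
    where
    length-layer : ∀ v → length (layer v (radius v)) ≤ 15
    length-layer v = ≤-pred (proj₂ (proj₂ (proj₂ (good-radius v))))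

    length-Q : length Q ≤ 735
    length-Q = ≤-trans (length-concatMap _ centres (All.universal length-layer centres)) (*-monoˡ-≤ 15 length-centres)

  Q-dominates-cut : ∀ {x} → Cut x → Any (λ p → Walk Adj 2 p x) Q
  Q-dominates-cut {x} cut with find cut | find (P-dominates x)
  ... | v , v∈ , x∈layer | p , p∈ , px = lose (∈-concatMap⁺ (λ v → layer v (radius v)) {xs = centres} (lose v∈ p∈layer)) px
    where
    p∈layer : p ∈ layer v (radius v)
    p∈layer = ∈-filter⁺ (λ p → near? (radius v) (dist v p)) p∈
      (subst (λ z → Near z (dist v p)) x∈layer (meet-near (subst (λ z → suc z < k) (sym x∈layer) (radius<k v)) (reverse symm px)))

  -- Two steps from `Q` reach the cut, and a third reaches its neighbours.
  Q-near : ∀ {x} → N[Cut] x → Any (λ p → dist p x ≤ 3) Q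
  Q-near (inj₁ cut)            = Any.map (λ px → m≤n⇒m≤1+n (walk-dist px)) (Q-dominates-cut cut)
  Q-near (inj₂ (y , cut , yx)) = Any.map (λ py → walk-dist (py ∷ʳ yx)) (Q-dominates-cut cut)

  colouring-near-cut = two-colourable-near Q 7Q+3<k Q-near

  -- Two kinds of ball that cannot be left off the cut: the inside of a chosen sphere, and a ball
  -- around any vertex cut short by an empty level `j < h`.
  Region : Vertex G → Vertex G → Set
  Region v x = (v ∈ centres × dist v x < radius v)
             ⊎ (∃[ j ] ¬ (∃[ y ] dist v y ≡ toℕ {h} j) × dist v x < toℕ j)

  region? : Decidable Region
  region? v x = (Any.any? (v Fin.≟_) centres ×-dec (dist v x <? radius v))
          ⊎-dec Fin.any? (λ j → ¬? (rich-at? v j) ×-dec (dist v x <? toℕ j))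

  colouring-off-cut = two-colourable {C = Region} {S = λ x → ¬ Cut x} (λ v → v) region? ball (λ _ → cover _) closed
    where
    ball : ∀ {v x} → Region v x → ∃[ ℓ ] ℓ < k × Walk Adj ℓ v x
    ball {v} {x} reg = dist v x , d<k reg , dist-walk (d<k reg)
      where
      d<k : Region v x → dist v x < k
      d<k (inj₁ (_ , d<)) = <-trans d< (<-trans (n<1+n _) (radius<k v))
      d<k (inj₂ (j , _ , d<)) = <-trans d< (<-≤-trans (Fin.toℕ<n j) (≤-trans (m≤m+n h 2) h+2≤k))

    cover : ∀ x → ∃[ v ] Region v x
    cover x with rich? x
    ... | yes rich with find (proj₂ (proj₂ (proj₂ net)) (∈-allFin x) rich)
    ...   | v , v∈ , d≤r = v , inj₁ (v∈ , ≤-<-trans d≤r (r<radius v))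
    cover x | no ¬rich with Fin.¬∀⟶∃¬ h _ (rich-at? x) ¬rich
    -- The empty level is not 0, because `x` attains that one; so `x` lies in its own ball.
    ...   | j , empty = x , inj₂ (j , empty , ≤∧≢⇒< (≤-trans (≤-reflexive (dist-refl x)) z≤n) (λ eq → empty (x , eq)))

    -- An edge raises the distance by at most one, so leaving the ball means landing on the cut or
    -- on the empty level.
    closed : ∀ {v x y} → ¬ Cut x → ¬ Cut y → Adj x y → Region v x → Region v y
    closed _ ¬cut xy (inj₁ (v∈ , d<)) = inj₁ (v∈ , ≤∧≢⇒< (≤-trans (dist-step xy) d<) (λ eq → ¬cut (lose v∈ eq)))
    closed _ _    xy (inj₂ (j , empty , d<)) = inj₂ (j , empty , ≤∧≢⇒< (≤-trans (dist-step xy) d<) (λ eq → empty (_ , eq)))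

  colourable : Colourable 3 G
  colourable = three-colourable G cut? N[cut]? (proj₁ colouring-near-cut) (proj₁ colouring-off-cut)
    inj₁ (λ cut xy → inj₂ (_ , cut , xy)) (proj₂ colouring-near-cut) (proj₂ colouring-off-cut)

-- The rational degree condition and the theorem

open import Data.Integer using (+_)

-- Passing to unnormalised fractions turns the inequality into a cross-multiplied one between
-- integers.
1/N*n≤d⇒n≤N*d : ∀ N n d .{{_ : NonZero N}} → (+ 1 / N) ℚ.* ℕ→ℚ n ℚ.≤ ℕ→ℚ d → n ≤ N * d
1/N*n≤d⇒n≤N*d (suc N) n d le = drop (begin
  mkℚᵘ (+ 1) N ℚᵘ.* mkℚᵘ (+ n) 0               ≃⟨ ℚᵘ.*-cong (ℚ.toℚᵘ-fromℚᵘ (mkℚᵘ (+ 1) N)) (ℚ.toℚᵘ-fromℚᵘ (mkℚᵘ (+ n) 0)) ⟨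
  ℚ.toℚᵘ (+ 1 / suc N) ℚᵘ.* ℚ.toℚᵘ (ℕ→ℚ n)     ≃⟨ ℚ.toℚᵘ-homo-* (+ 1 / suc N) (ℕ→ℚ n) ⟨
  ℚ.toℚᵘ ((+ 1 / suc N) ℚ.* ℕ→ℚ n)             ≤⟨ ℚ.toℚᵘ-mono-≤ le ⟩
  ℚ.toℚᵘ (ℕ→ℚ d)                               ≃⟨ ℚ.toℚᵘ-fromℚᵘ (mkℚᵘ (+ d) 0) ⟩
  mkℚᵘ (+ d) 0                                 ∎)
  where
  open ℚᵘ.≤-Reasoning
  drop : mkℚᵘ (+ 1) N ℚᵘ.* mkℚᵘ (+ n) 0 ℚᵘ.≤ mkℚᵘ (+ d) 0 → n ≤ suc N * d
  drop (ℚᵘ.*≤* le) = subst (n ≤_) (trans (cong (d *_) (*-identityʳ (suc N))) (*-comm d (suc N)))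
    (ℤ.drop‿+≤+ (subst₂ ℤ._≤_ (trans (ℤ.*-identityʳ _) (ℤ.*-identityˡ _)) (sym (ℤ.pos-* d (suc N * 1))) le))

1/N≤1 : ∀ N .{{_ : NonZero N}} → + 1 / N ℚ.≤ ℚ.1ℚ
1/N≤1 (suc N) = ℚ.toℚᵘ-cancel-≤ (ℚᵘ.≤-trans (ℚᵘ.≤-reflexive (ℚ.toℚᵘ-fromℚᵘ (mkℚᵘ (+ 1) N)))
  (ℚᵘ.*≤* (ℤ.+≤+ (s≤s z≤n))))

0≤1/N : ∀ N .{{_ : NonZero N}} → ℚ.0ℚ ℚ.≤ + 1 / N
0≤1/N N = ℚ.nonNegative⁻¹ (+ 1 / N) {{ℚ.normalize-nonNeg 1 N}}

minDegree≤degree : ∀ (G : Graph) v → minDegree G ≤ Graph.degree G v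
minDegree≤degree G v = All.lookup (min≤xs (order G) _) (∈-map⁺ (Graph.degree G) (∈-allFin v))

theorem1p1 : (t k : ℕ) (k≥ : k ≥ 5490 + 45 * t) →
    let β : ℚ
        β = _/_ (+ 1) (2 * k + t) {{2k+t-nonZero t k k≥}}
    in ((G : Graph) → G IsFreeOf 𝒞[2 k -1] → β ℚ.* ℕ→ℚ (order G) ℚ.≤ ℕ→ℚ (minDegree G) → Colourable 3 G)
       × (δχ[ 𝒞[2 k -1] , 3 ]≤ β)
-- `β` is itself admissible, so it witnesses the infimum below every `r > β`.
theorem1p1 t k k≥ = colourable , λ r β<r → β , (0≤1/N m , 1/N≤1 m , colourable) , β<r
  where
  m = 2 * k + t

  instance
    m≢0 : NonZero m
    m≢0 = 2k+t-nonZero t k k≥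

  β : ℚ
  β = + 1 / m

  45m≤91k : 45 * m ≤ 91 * k
  45m≤91k = begin
    45 * (2 * k + t)           ≡⟨ solve 2 (λ k t → con 45 :* (con 2 :* k :+ t) := con 90 :* k :+ con 45 :* t) refl k t ⟩
    90 * k + 45 * t            ≤⟨ +-monoʳ-≤ (90 * k) (≤-trans (m≤n+m (45 * t) 5490) k≥) ⟩
    90 * k + k                 ≡⟨ +-comm (90 * k) k ⟩
    91 * k                     ∎
    where open ≤-Reasoning

  colourable : (G : Graph) → G IsFreeOf 𝒞[2 k -1] → β ℚ.* ℕ→ℚ (order G) ℚ.≤ ℕ→ℚ (minDegree G) → Colourable 3 G
  colourable G free dense with minDegree G in eq | 1/N*n≤d⇒n≤N*d m (order G) (minDegree G) dense
  -- Minimum degree 0 forces order 0, where the empty colouring works.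
  ... | zero  | n≤0 = (λ v → ⊥-elim (empty v)) , λ {v} → ⊥-elim (empty v)
    where
    empty : ¬ Vertex G
    empty v = n≮0 (<-≤-trans (Fin.toℕ<n v) (≤-trans n≤0 (≤-reflexive (*-zeroʳ m))))
  ... | suc δ | n≤mδ = DenseOddGirth.colourable G k (no-odd-closed-walk G {k} free) m δ
    (λ v → ≤-trans (≤-reflexive (sym eq)) (minDegree≤degree G v)) n≤mδ (scales (≤-trans (m≤m+n 5490 (45 * t)) k≥) 45m≤91k)
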